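{- There is an $11\frac{1}{9}$-competitive algorithm for non-preemptive online machine minimization with a uniform deadline (i.e. $d_j=d$ for all jobs $j$).
   Context: Machine minimization with deadlines: each job $j$ of a finite instance has integer release date $r_j$, processing time $p_j$ and deadline $d_j$. A feasible non-preemptive schedule on a given number of identical machines processes each job uninterrupted on a single machine for $p_j$ consecutive time units within $[r_j,d_j]$, each machine processing at most one job at a time. $m$ is the minimum number of machines admitting such a schedule. Online: each job becomes known only at its release date, the algorithm makes irrevocable decisions (including opening machines) over time and does not know $m$. An algorithm is $c$-competitive if on every instance it produces a feasible schedule using at most $c\cdot m$ machines. -}

module Defs where

open import Data.Nat using (ℕ; zero; suc; _+_; _*_; _≤_; _<_; _≤?_)
open import Data.List using (List; []; _∷_; length; takeWhile)
open import Data.List.Relation.Unary.All using (All)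
open import Data.List.Relation.Unary.Linked using (Linked)
open import Data.Maybe using (Maybe; just; nothing)
open import Data.Product using (Σ; _×_; _,_)
open import Data.Sum using (_⊎_)
open import Relation.Binary.PropositionalEquality using (_≡_; _≢_)

-- A job with release date r and processing time p.
-- The (uniform) deadline d is a separate parameter of an instance.
record Job : Set where
  constructor job
  field
    r : ℕ
    p : ℕ
open Job public

record Assign : Set where
  constructor assign
  field
    machine : ℕ
    start   : ℕ
open Assign public

nth : {A : Set} → List A → ℕ → Maybe A
nth []       _       = nothing
nth (x ∷ xs) zero    = just x
nth (x ∷ xs) (suc i) = nth xs i

-- Instances are lists of jobs (job identity = position), given in
-- order of non-decreasing release dates.
SortedByRelease : List Job → Set
SortedByRelease = Linked (λ j k → r j ≤ r k)

-- Jobs released up to (and including) time t: a prefix of a sorted instance.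
released : ℕ → List Job → List Job
released t = takeWhile (λ j → r j ≤? t)

Feasible : ℕ → List Job → List Assign → ℕ → Set
Feasible d I S k =
  (length S ≡ length I) ×
  (∀ i x a → nth I i ≡ just x → nth S i ≡ just a →
     (r x ≤ start a) × (start a + p x ≤ d) × (machine a < k)) ×
  (∀ i j x y a b → i ≢ j → nth I i ≡ just x → nth I j ≡ just y →
     nth S i ≡ just a → nth S j ≡ just b → machine a ≡ machine b →
     (start a + p x ≤ start b) ⊎ (start b + p y ≤ start a))

IsOptimum : ℕ → List Job → ℕ → Set
IsOptimum d I m =
  (Σ (List Assign) λ S → Feasible d I S m) ×
  (∀ k S → Feasible d I S k → m ≤ k)

Algorithm : Set
Algorithm = ℕ → List Job → List Assign

-- Online (non-anticipation): whether and how job i is started at a time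
-- s ≤ t depends only on the jobs released up to time t.
Online : Algorithm → Set
Online A =
  ∀ d I I' t → SortedByRelease I → SortedByRelease I' →
  released t I ≡ released t I' →
  ∀ i a → i < length (released t I) →
  nth (A d I) i ≡ just a → start a ≤ t → nth (A d I') i ≡ just a

Competitive-100/9 : Algorithm → Set
Competitive-100/9 A =
  ∀ d I → SortedByRelease I → All (λ j → 1 ≤ p j) I →
  ∀ m → IsOptimum d I m →
  Σ ℕ λ u → Feasible d I (A d I) u × (9 * u ≤ 100 * m)

{-# OPTIONS --safe #-}

-- Call a job tight if 4 p > d - r, and dispatch every job at its release by first fit,
-- with separate machines for tight and loose jobs: a tight job must start at once,
-- a loose job may wait for at most (d - r) / 3. Suppose a job released at time t opens
-- a new machine, and let T = d - t.
--
-- If it is tight, then every tight machine is running a job at time t. In an optimal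
-- schedule at most one of these jobs per machine covers the time slot t, and at most
-- three start after t because each is longer than T / 4. So there are at most 4 m
-- tight machines.
--
-- If it is loose, then every loose machine is occupied beyond t + T / 3. Let V z be the
-- work on such a machine of jobs with d - r ≤ z. Then T < 2 V (2 T) + V (3 T), and since
-- the sum of V z over all machines is at most m z, there are fewer than 7 m loose
-- machines before the opening. Altogether at most 11 m ≤ (100 / 9) m machines are used.
module Submission where

open import Defs
open import Data.Empty using (⊥-elim)
open import Data.List using (List; []; _∷_; _++_; length; dropWhile)
open import Data.List.Properties using (takeWhile++dropWhile)
open import Data.List.Relation.Unary.All as All using (All; []; _∷_)
open import Data.List.Relation.Unary.AllPairs using (AllPairs; []; _∷_)
open import Data.List.Relation.Unary.Linked.Properties using (Linked⇒AllPairs)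
open import Data.Maybe using (just)
open import Data.Nat
open import Data.Nat.Properties
open import Data.Nat.Tactic.RingSolver using (solve-∀)
open import Data.Product using (Σ; ∃; ∃₂; _×_; _,_; proj₁; proj₂)
open import Data.Sum using (_⊎_; inj₁; inj₂; swap)
open import Function using (_∘_)
open import Relation.Binary.PropositionalEquality
open import Relation.Nullary using (Dec; yes; no; ¬_; contradiction)
open import Relation.Nullary.Decidable using (_×-dec_)

-- Linear inequalities and sums over lists.

private variable
  A : Set
  P : Set

-- A linear consequence of known inequalities is proved by adding them up to `L ≤ U` and cancelling
-- the surplus `R` common to both sides. Only two ring identities remain, and no subtraction occurs.
linear : ∀ R {L U X Y} → L ≤ U → X + R ≡ L → U ≡ Y + R → X ≤ Y
linear R {X = X} {Y} L≤U l u = +-cancelʳ-≤ R X Y (subst₂ _≤_ (sym l) u L≤U)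

infix 8 _when_

_when_ : ℕ → Dec P → ℕ
n when yes _ = n
n when no _  = 0

when-≤ : ∀ {n k} (P? : Dec P) → (P → n ≤ k) → n when P? ≤ k
when-≤ (yes p) n≤k = n≤k p
when-≤ (no _)  _   = z≤n

≤-when : ∀ {n} (P? : Dec P) → P → n ≤ n when P?
≤-when (yes _) _ = ≤-refl
≤-when (no ¬p) p = contradiction p ¬p

sumBy : (A → ℕ) → List A → ℕ
sumBy f []       = 0
sumBy f (x ∷ xs) = f x + sumBy f xs

sumBy-mono : ∀ {f g : A → ℕ} {xs} → All (λ x → f x ≤ g x) xs → sumBy f xs ≤ sumBy g xs
sumBy-mono []       = z≤n
sumBy-mono (p ∷ ps) = +-mono-≤ p (sumBy-mono ps)

sumBy-+ : ∀ (f g : A → ℕ) xs → sumBy (λ x → f x + g x) xs ≡ sumBy f xs + sumBy g xs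
sumBy-+ f g []       = refl
sumBy-+ f g (x ∷ xs) =
  trans (cong (f x + g x +_) (sumBy-+ f g xs)) (interchange (f x) (g x) _ _)
  where
  interchange : ∀ a b c e → (a + b) + (c + e) ≡ (a + c) + (b + e)
  interchange = solve-∀

sumBy-* : ∀ k (f : A → ℕ) xs → sumBy (λ x → k * f x) xs ≡ k * sumBy f xs
sumBy-* k f []       = sym (*-zeroʳ k)
sumBy-* k f (x ∷ xs) =
  trans (cong (k * f x +_) (sumBy-* k f xs)) (sym (*-distribˡ-+ k (f x) _))

sumBy-≤0 : ∀ {f : A → ℕ} {xs} → All (λ x → f x ≤ 0) xs → sumBy f xs ≤ 0
sumBy-≤0 []       = z≤n
sumBy-≤0 (p ∷ ps) = +-mono-≤ p (sumBy-≤0 ps)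

-- Scheduled jobs

Slot : Set
Slot = Job × Assign

machineOf onset finish : Slot → ℕ
machineOf (_ , a) = machine a
onset     (_ , a) = start a
finish    (x , a) = start a + p x

Within : ℕ → ℕ → Slot → Set
Within d m (x , a) = (r x ≤ start a) × (start a + p x ≤ d) × (machine a < m)

Separate : Slot → Slot → Set
Separate s t = machineOf s ≡ machineOf t → (finish s ≤ onset t) ⊎ (finish t ≤ onset s)

-- Pairing jobs with assignments turns the indexed conditions of `Feasible` into `All` and
-- `AllPairs`, which suit induction on the list.
slots : List Job → List Assign → List Slot
slots (x ∷ I) (a ∷ S) = (x , a) ∷ slots I S
slots _       _       = []

feasible⇒within : ∀ {d m} I S → Feasible d I S m → All (Within d m) (slots I S)
feasible⇒within []      _       _                 = []
feasible⇒within (x ∷ I) []      _                 = []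
feasible⇒within (x ∷ I) (a ∷ S) (len , win , sep) =
  win 0 x a refl refl ∷
  feasible⇒within I S (suc-injective len , (λ i → win (suc i)) ,
    λ i j x y a b i≢j → sep (suc i) (suc j) x y a b (i≢j ∘ suc-injective))

feasible⇒separate : ∀ {d m} I S → Feasible d I S m → AllPairs Separate (slots I S)
feasible⇒separate []      _       _                 = []
feasible⇒separate (x ∷ I) []      _                 = []
feasible⇒separate (x ∷ I) (a ∷ S) (len , win , sep) =
  separateFrom I S (λ j y b → sep 0 (suc j) x y a b (λ ())) ∷
  feasible⇒separate I S (suc-injective len , (λ i → win (suc i)) ,
    λ i j x y a b i≢j → sep (suc i) (suc j) x y a b (i≢j ∘ suc-injective))
  where
  separateFrom : ∀ I S →
    (∀ j y b → just x ≡ just x → nth I j ≡ just y → just a ≡ just a →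
       nth S j ≡ just b → Separate (x , a) (y , b)) →
    All (Separate (x , a)) (slots I S)
  separateFrom []      _       _ = []
  separateFrom (y ∷ I) []      _ = []
  separateFrom (y ∷ I) (b ∷ S) h =
    h 0 y b refl refl refl refl ∷ separateFrom I S (λ j → h (suc j))

slots-lookup : ∀ {Q : Slot → Set} I S i {x a} → All Q (slots I S) →
  nth I i ≡ just x → nth S i ≡ just a → Q (x , a)
slots-lookup (x ∷ I) (a ∷ S) zero    (q ∷ _)  refl refl = q
slots-lookup (x ∷ I) (a ∷ S) (suc i) (_ ∷ qs) e    f    = slots-lookup I S i qs e f

slots-separate : ∀ I S i j {x y a b} → AllPairs Separate (slots I S) → i ≢ j →
  nth I i ≡ just x → nth I j ≡ just y → nth S i ≡ just a → nth S j ≡ just b →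
  Separate (x , a) (y , b)
slots-separate (x ∷ I) (a ∷ S) zero zero _ i≢j = contradiction refl i≢j
slots-separate (x ∷ I) (a ∷ S) zero (suc j) (q ∷ _) _ refl e refl f =
  slots-lookup I S j q e f
slots-separate (x ∷ I) (a ∷ S) (suc i) zero (q ∷ _) _ e refl f refl =
  swap ∘ slots-lookup I S i q e f ∘ sym
slots-separate (x ∷ I) (a ∷ S) (suc i) (suc j) (_ ∷ qs) i≢j =
  slots-separate I S i j qs (i≢j ∘ cong suc)

sumBy-slots : ∀ (f : Job → ℕ) I S → length S ≡ length I →
  sumBy (f ∘ proj₁) (slots I S) ≡ sumBy f I
sumBy-slots f []      _       _   = refl
sumBy-slots f (x ∷ I) (a ∷ S) len = cong (f x +_) (sumBy-slots f I S (suc-injective len))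

-- Induction on `m`: a slot on a machine below `suc m` is on machine `m`, which contributes at most
-- `B`, or on a machine below `m`.
sumBy-machines : ∀ (f : Slot → ℕ) B m Z →
  (∀ k → sumBy (λ s → f s when (machineOf s ≟ k)) Z ≤ B) →
  sumBy (λ s → f s when (machineOf s <? m)) Z ≤ m * B
sumBy-machines f B zero Z _ =
  sumBy-≤0 (All.universal (λ s → when-≤ {n = f s} (machineOf s <? 0) λ ()) Z)
sumBy-machines f B (suc m) Z h =
  ≤-trans (sumBy-mono (All.universal split Z))
    (≤-trans (≤-reflexive (sumBy-+ _ _ Z)) (+-mono-≤ (h m) (sumBy-machines f B m Z h)))
  where
  split : ∀ s → f s when (machineOf s <? suc m) ≤
    f s when (machineOf s ≟ m) + f s when (machineOf s <? m)
  split s = when-≤ (machineOf s <? suc m) λ k<1+m → case (m<1+n⇒m<n∨m≡n k<1+m)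
    where
    case : machineOf s < m ⊎ machineOf s ≡ m → _
    case (inj₁ k<m) = ≤-trans (≤-when (machineOf s <? m) k<m) (m≤n+m _ _)
    case (inj₂ k≡m) = ≤-trans (≤-when (machineOf s ≟ m) k≡m) (m≤m+n _ _)

-- Load of a machine in a time window.

Inside : ℕ → ℕ → ℕ → Slot → Set
Inside k a b s = machineOf s ≡ k × a ≤ onset s × finish s ≤ b

inside? : ∀ k a b s → Dec (Inside k a b s)
inside? k a b s = (machineOf s ≟ k) ×-dec (a ≤? onset s) ×-dec (finish s ≤? b)

load : ℕ → ℕ → ℕ → Slot → ℕ
load k a b s = p (proj₁ s) when inside? k a b s

load-split : ∀ {k a b} s t → Separate s t → machineOf s ≡ k →
  load k a b t ≤ load k a (onset s) t + load k (finish s) b t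
load-split {k} {a} {b} s t sep refl = when-≤ (inside? k a b t) cases
  where
  cases : Inside k a b t → _
  cases (t≡k , a≤t , t≤b) with sep (sym t≡k)
  ... | inj₁ s≤t = ≤-trans (≤-when (inside? k (finish s) b t) (t≡k , s≤t , t≤b)) (m≤n+m _ _)
  ... | inj₂ t≤s = ≤-trans (≤-when (inside? k a (onset s) t) (t≡k , a≤t , t≤s)) (m≤m+n _ _)

-- A job inside the window cuts it into the part before its onset and the part after its finish. By
-- separation every other inside job lies in one of them, so the recursion bounds both parts over
-- the same tail.
load-bound : ∀ k {a b} Z → AllPairs Separate Z → a ≤ b → a + sumBy (load k a b) Z ≤ b
load-bound k {a} []      _          a≤b = ≤-trans (≤-reflexive (+-identityʳ a)) a≤b
load-bound k {a} {b} (s ∷ Z) (sep ∷ seps) a≤b with inside? k a b s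
... | no  _               = load-bound k Z seps a≤b
... | yes (s≡k , a≤s , s≤b) =
  ≤-trans (+-monoʳ-≤ a (+-monoʳ-≤ q split))
    (linear (onset s)
      (+-mono-≤ (load-bound k Z seps a≤s) (load-bound k Z seps s≤b))
      (regroup a q (onset s) _ _) (+-comm (onset s) b))
  where
  q = p (proj₁ s)
  regroup : ∀ a q s u v → a + (q + (u + v)) + s ≡ (a + u) + (s + q + v)
  regroup = solve-∀
  split : sumBy (load k a b) Z ≤ sumBy (load k a (onset s)) Z + sumBy (load k (finish s) b) Z
  split = ≤-trans (sumBy-mono (All.map (λ {t} σ → load-split s t σ s≡k) sep))
                  (≤-reflexive (sumBy-+ _ _ Z))

-- Lower bounds on the optimum

work : ℕ → ℕ → Job → ℕ
work d z j = p j when (d ≤? r j + z)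

-- First fit starts tight jobs at release, so these are the tight jobs it is processing in the slot
-- `t`. The condition mentions only the job, so the same jobs can be counted in any other schedule.
Running : ℕ → ℕ → Job → Set
Running d t j = d < r j + 4 * p j × r j ≤ t × t < r j + p j

running? : ∀ d t j → Dec (Running d t j)
running? d t j = (d <? r j + 4 * p j) ×-dec (r j ≤? t) ×-dec (t <? r j + p j)

running : ℕ → ℕ → Job → ℕ
running d t j = 1 when running? d t j

module Optimum {d m I S} (feasible : Feasible d I S m) where

  private
    Z : List Slot
    Z = slots I S

    within : All (Within d m) Z
    within = feasible⇒within I S feasible

    separate : AllPairs Separate Z
    separate = feasible⇒separate I S feasible

  total-bound : ∀ (f : Job → ℕ) B →
    (∀ k → sumBy (λ s → f (proj₁ s) when (machineOf s ≟ k)) Z ≤ B) →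
    sumBy f I ≤ m * B
  total-bound f B h = ≤-trans (≤-reflexive (sym (sumBy-slots f I S (proj₁ feasible))))
    (≤-trans (sumBy-mono (All.map (λ {s} w → ≤-when (machineOf s <? m) (proj₂ (proj₂ w))) within))
             (sumBy-machines (f ∘ proj₁) B m Z h))

  -- Jobs with `d - r ≤ z` must be processed inside `[d - z, d]`, and each machine offers at most
  -- `z` time there. If `z` exceeds `d`, the truncated window `[0, d]` is shorter still.
  work-bound : ∀ z → sumBy (work d z) I ≤ m * z
  work-bound z = total-bound (work d z) z λ k →
    ≤-trans (sumBy-mono (All.map (λ {s} → late k s) within)) (window k)
    where
    late : ∀ k s → Within d m s →
      work d z (proj₁ s) when (machineOf s ≟ k) ≤ load k (d ∸ z) d s
    late k s (r≤s , s≤d , _) = when-≤ (machineOf s ≟ k) λ s≡k →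
      when-≤ (d ≤? r (proj₁ s) + z) λ d≤r+z →
      ≤-when (inside? k (d ∸ z) d s)
        (s≡k , ≤-trans (≤-trans (∸-monoˡ-≤ z d≤r+z) (≤-reflexive (m+n∸n≡m _ z))) r≤s , s≤d)
    window : ∀ k → sumBy (load k (d ∸ z) d) Z ≤ z
    window k = +-cancelˡ-≤ (d ∸ z) _ _
      (≤-trans (load-bound k Z separate (m∸n≤m d z))
        (≤-trans (m≤n+m∸n d z) (≤-reflexive (+-comm z (d ∸ z)))))

  -- No schedule starts a job before its release, so a running job finishes after `t` in every
  -- schedule. Hence it covers the slot `t` or starts at `suc t` or later.
  running-bound : ∀ {t} → t < d → sumBy (running d t) I ≤ m * 4
  running-bound {t} t<d = total-bound (running d t) 4 λ k →
    ≤-trans (sumBy-mono (All.map (λ {s} → cases k s) within))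
      (≤-trans (≤-reflexive (sumBy-+ _ _ Z)) (+-mono-≤ (one k Z separate) (three k)))
    where
    Covering : ℕ → Slot → Set
    Covering k s = machineOf s ≡ k × onset s ≤ t × t < finish s

    covering? : ∀ k s → Dec (Covering k s)
    covering? k s = (machineOf s ≟ k) ×-dec (onset s ≤? t) ×-dec (t <? finish s)

    Later : ℕ → Slot → Set
    Later k s = Inside k (suc t) d s × Running d t (proj₁ s)

    later? : ∀ k s → Dec (Later k s)
    later? k s = inside? k (suc t) d s ×-dec running? d t (proj₁ s)

    cases : ∀ k s → Within d m s → running d t (proj₁ s) when (machineOf s ≟ k) ≤
      1 when covering? k s + 1 when later? k s
    cases k s (r≤s , s≤d , _) = when-≤ (machineOf s ≟ k) λ s≡k →
      when-≤ (running? d t (proj₁ s)) λ run → case s≡k run (onset s ≤? t)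
      where
      case : machineOf s ≡ k → Running d t (proj₁ s) → Dec (onset s ≤ t) → _
      case s≡k (_ , _ , t<e) (yes s≤t) = ≤-trans
        (≤-when (covering? k s) (s≡k , s≤t , <-≤-trans t<e (+-monoˡ-≤ _ r≤s))) (m≤m+n _ _)
      case s≡k run (no s≰t) = ≤-trans
        (≤-when (later? k s) ((s≡k , ≰⇒> s≰t , s≤d) , run)) (m≤n+m _ _)

    one : ∀ k Z → AllPairs Separate Z → sumBy (λ s → 1 when covering? k s) Z ≤ 1
    one k []      _            = z≤n
    one k (s ∷ Z) (sep ∷ seps) with covering? k s
    ... | no  _                  = one k Z seps
    ... | yes (s≡k , s≤t , t<s) = s≤s (sumBy-≤0 (All.map (λ {u} → none u) sep))
      where
      none : ∀ u → Separate s u → 1 when covering? k u ≤ 0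
      none u σ = when-≤ (covering? k u) λ (u≡k , u≤t , t<u) →
        ⊥-elim (clash (σ (trans s≡k (sym u≡k))) u≤t t<u)
        where
        clash : _ → onset u ≤ t → t < finish u → _
        clash (inj₁ s≤u) u≤t _ = <-irrefl refl (<-≤-trans t<s (≤-trans s≤u u≤t))
        clash (inj₂ u≤s) _ t<u = <-irrefl refl (<-≤-trans t<u (≤-trans u≤s s≤t))

    three : ∀ k → sumBy (λ s → 1 when later? k s) Z ≤ 3
    -- Each later job has `4 p ≥ d - t`, while their total length is at most `d - suc t`. The
    -- missing unit makes the inequality strict, so there are fewer than four.
    three k = s≤s⁻¹ (*-cancelˡ-< (d ∸ t) _ _ short)
      where
      weigh : ∀ s → (d ∸ t) * 1 when later? k s ≤ 4 * load k (suc t) d s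
      weigh s with later? k s
      ... | no  _ = ≤-trans (≤-reflexive (*-zeroʳ (d ∸ t))) z≤n
      ... | yes (ins , tight , r≤t , _) = ≤-trans (≤-reflexive (*-identityʳ (d ∸ t)))
        (≤-trans (m≤n+o⇒m∸n≤o d t (≤-trans (<⇒≤ tight) (+-monoˡ-≤ _ r≤t)))
          (*-monoʳ-≤ 4 (≤-when (inside? k (suc t) d s) ins)))
      short : (d ∸ t) * sumBy (λ s → 1 when later? k s) Z < (d ∸ t) * 4
      short = ≤-<-trans (≤-reflexive (sym (sumBy-* (d ∸ t) _ Z)))
        (≤-<-trans (sumBy-mono (All.universal weigh Z))
          (≤-<-trans (≤-reflexive (sumBy-* 4 (load k (suc t) d) Z))
            (<-≤-trans (*-monoʳ-< 4 (m+n≤o⇒m≤o∸n (suc _) {t} (≤-trans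
              (≤-reflexive (cong suc (+-comm _ t))) (load-bound k Z separate t<d))))
              (≤-reflexive (*-comm 4 (d ∸ t))))))

-- The algorithm

data Class : Set where
  tight loose : Class

_≟ᶜ_ : (c c′ : Class) → Dec (c ≡ c′)
tight ≟ᶜ tight = yes refl
tight ≟ᶜ loose = no λ ()
loose ≟ᶜ tight = no λ ()
loose ≟ᶜ loose = yes refl

-- Latest job first; every job starts as soon as it is released and the earlier
-- jobs of the machine have finished.
Machine : Set
Machine = Class × List Job

end : List Job → ℕ
end []      = 0
end (j ∷ h) = (r j ⊔ end h) + p j

endOf : Machine → ℕ
endOf (_ , h) = end h

-- The first component forces the class of the job. For loose jobs the second says
-- `e ≤ r + (d - r) / 3`, cleared of the fraction.
Admissible : ℕ → Class → Job → ℕ → Set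
Admissible d tight j e = d < r j + 4 * p j × e ≤ r j
Admissible d loose j e = r j + 4 * p j ≤ d × 3 * e ≤ 2 * r j + d

admissible? : ∀ d c j e → Dec (Admissible d c j e)
admissible? d tight j e = (d <? r j + 4 * p j) ×-dec (e ≤? r j)
admissible? d loose j e = (r j + 4 * p j ≤? d) ×-dec (3 * e ≤? 2 * r j + d)

classify : ∀ d j → ∃ λ c → Admissible d c j 0
classify d j with r j + 4 * p j ≤? d
... | yes l = loose , l , z≤n
... | no ¬l = tight , ≰⇒> ¬l , z≤n

-- The graph of one first-fit step: `skip` records the refusal of each machine passed over, which
-- the counting needs later. The start `r j ⊔ 0` in `launch` agrees by computation with
-- `end (j ∷ [])`.
data Place (d : ℕ) (j : Job) : List Machine → List Machine → Assign → Set where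
  launch : ∀ {c} → Admissible d c j 0 →
    Place d j [] ((c , j ∷ []) ∷ []) (assign 0 (r j ⊔ 0))
  reuse  : ∀ {c h Ms} → Admissible d c j (end h) →
    Place d j ((c , h) ∷ Ms) ((c , j ∷ h) ∷ Ms) (assign 0 (r j ⊔ end h))
  skip   : ∀ {c h Ms Ms′ a} → ¬ Admissible d c j (end h) → Place d j Ms Ms′ a →
    Place d j ((c , h) ∷ Ms) ((c , h) ∷ Ms′) (assign (suc (machine a)) (start a))

place : ∀ d j Ms → ∃₂ (Place d j Ms)
place d j [] = _ , _ , launch (proj₂ (classify d j))
place d j ((c , h) ∷ Ms) with admissible? d c j (end h)
... | yes adm = _ , _ , reuse adm
... | no ¬adm = _ , _ , skip ¬adm (proj₂ (proj₂ (place d j Ms)))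

after : ℕ → List Machine → Job → List Machine
after d Ms j = proj₁ (place d j Ms)

schedule : ℕ → List Machine → List Job → List Assign
schedule d Ms []      = []
schedule d Ms (j ∷ I) = proj₁ (proj₂ (place d j Ms)) ∷ schedule d (after d Ms j) I

final : ℕ → List Machine → List Job → List Machine
final d Ms []      = Ms
final d Ms (j ∷ I) = final d (after d Ms j) I

firstFit : Algorithm
firstFit d = schedule d []

-- Non-anticipation.

schedule-prefix : ∀ d Ms (R X Y : List Job) i → i < length R →
  nth (schedule d Ms (R ++ X)) i ≡ nth (schedule d Ms (R ++ Y)) i
schedule-prefix d Ms (j ∷ R) X Y zero    _         = refl
schedule-prefix d Ms (j ∷ R) X Y (suc i) (s≤s i<n) = schedule-prefix d (after d Ms j) R X Y i i<n

-- Jobs are dispatched irrevocably in list order, and `released t` is a prefix of the list; equal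
-- prefixes therefore receive equal assignments.
firstFit-online : Online firstFit
firstFit-online d I I′ t _ _ eq i a i<n e _ = trans (sym same) e
  where
  notYet : List Job → List Job
  notYet = dropWhile (λ j → r j ≤? t)
  whole : ∀ J → released t J ++ notYet J ≡ J
  whole = takeWhile++dropWhile (λ j → r j ≤? t)
  same : nth (firstFit d I) i ≡ nth (firstFit d I′) i
  same = begin
    nth (firstFit d I) i
      ≡⟨ cong (λ J → nth (firstFit d J) i) (whole I) ⟨
    nth (firstFit d (released t I ++ notYet I)) i
      ≡⟨ schedule-prefix d [] (released t I) (notYet I) (notYet I′) i i<n ⟩
    nth (firstFit d (released t I ++ notYet I′)) i
      ≡⟨ cong (λ R → nth (firstFit d (R ++ notYet I′)) i) eq ⟩
    nth (firstFit d (released t I′ ++ notYet I′)) i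
      ≡⟨ cong (λ J → nth (firstFit d J) i) (whole I′) ⟩
    nth (firstFit d I′) i ∎
    where open ≡-Reasoning

schedule-length : ∀ d Ms I → length (schedule d Ms I) ≡ length I
schedule-length d Ms []      = refl
schedule-length d Ms (j ∷ I) = cong suc (schedule-length d (after d Ms j) I)

-- Feasibility

-- The default 0 treats an unopened machine as free from the beginning, so that launching also only
-- increases ends.
endAt : ℕ → List Machine → ℕ
endAt k       []       = 0
endAt zero    (M ∷ Ms) = endOf M
endAt (suc k) (M ∷ Ms) = endAt k Ms

place-endAt : ∀ {d j Ms Ms′ a} → Place d j Ms Ms′ a → endAt (machine a) Ms′ ≡ start a + p j
place-endAt (launch _) = refl
place-endAt (reuse _)  = refl
place-endAt (skip _ q) = place-endAt q

endAt-mono : ∀ {d j Ms Ms′ a} → Place d j Ms Ms′ a → ∀ k → endAt k Ms ≤ endAt k Ms′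
endAt-mono         (launch _)        k       = z≤n
endAt-mono {j = j} (reuse {h = h} _) zero    = ≤-trans (m≤n⊔m (r j) (end h)) (m≤m+n _ _)
endAt-mono         (reuse _)         (suc k) = ≤-refl
endAt-mono         (skip _ q)        zero    = ≤-refl
endAt-mono         (skip _ q)        (suc k) = endAt-mono q k

endAt-start : ∀ {d j Ms Ms′ a} → Place d j Ms Ms′ a → endAt (machine a) Ms ≤ start a
endAt-start         (launch _)        = z≤n
endAt-start {j = j} (reuse {h = h} _) = m≤n⊔m (r j) (end h)
endAt-start         (skip _ q)        = endAt-start q

place-length : ∀ {d j Ms Ms′ a} → Place d j Ms Ms′ a →
  machine a < length Ms′ × length Ms ≤ length Ms′
place-length (launch _) = s≤s z≤n , z≤n
place-length (reuse _)  = s≤s z≤n , ≤-refl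
place-length (skip _ q) = s≤s (proj₁ (place-length q)) , s≤s (proj₂ (place-length q))

final-length : ∀ d Ms I → length Ms ≤ length (final d Ms I)
final-length d Ms []      = ≤-refl
final-length d Ms (j ∷ I) =
  ≤-trans (proj₂ (place-length (proj₂ (proj₂ (place d j Ms))))) (final-length d (after d Ms j) I)

loose-start : ∀ {d j e} → r j + 4 * p j ≤ d → 3 * e ≤ 2 * r j + d → 3 * (r j ⊔ e) ≤ 2 * r j + d
loose-start {d} {j} {e} short wait = ≤-trans (≤-reflexive (*-distribˡ-⊔ 3 (r j) e))
  (⊔-lub (≤-trans (≤-reflexive (thrice (r j))) (+-monoʳ-≤ (2 * r j) (m+n≤o⇒m≤o (r j) short))) wait)
  where
  thrice : ∀ r → 3 * r ≡ 2 * r + r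
  thrice = solve-∀

-- Waiting takes at most 1/3 of `d - r` and processing at most 1/4, so the job ends by
-- `r + 7/12 (d - r)`.
loose-finish : ∀ {d j e} → r j + 4 * p j ≤ d → 3 * e ≤ 2 * r j + d →
  12 * ((r j ⊔ e) + p j) ≤ 5 * r j + 7 * d
loose-finish {d} {j} {e} short wait =
  linear (3 * r j) (+-mono-≤ (*-monoʳ-≤ 4 (loose-start {j = j} short wait)) (*-monoʳ-≤ 3 short))
    (lhs (r j) (r j ⊔ e) (p j)) (rhs (r j) d)
  where
  lhs : ∀ r s p → 12 * (s + p) + 3 * r ≡ 4 * (3 * s) + 3 * (r + 4 * p)
  lhs = solve-∀
  rhs : ∀ r d → 4 * (2 * r + d) + 3 * d ≡ 5 * r + 7 * d + 3 * r
  rhs = solve-∀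

admissible-finish : ∀ {d} c {j e} → Admissible d c j e → r j + p j ≤ d → (r j ⊔ e) + p j ≤ d
admissible-finish tight {j} (_ , e≤r) fits =
  ≤-trans (≤-reflexive (cong (_+ p j) (m≥n⇒m⊔n≡m e≤r))) fits
admissible-finish {d} loose {j} {e} (short , wait) _ = *-cancelˡ-≤ 12
  (≤-trans (loose-finish {j = j} short wait)
    (≤-trans (+-monoˡ-≤ (7 * d) (*-monoʳ-≤ 5 (m+n≤o⇒m≤o (r j) short)))
      (≤-reflexive (sym (*-distribʳ-+ d 5 7)))))

place-within : ∀ {d j Ms Ms′ a} → Place d j Ms Ms′ a → r j + p j ≤ d →
  r j ≤ start a × start a + p j ≤ d
place-within {j = j} (launch {c} adm)     fits = m≤m⊔n (r j) 0 , admissible-finish c adm fits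
place-within {j = j} (reuse {c} {h} adm)  fits = m≤m⊔n (r j) (end h) , admissible-finish c adm fits
place-within         (skip _ q)           fits = place-within q fits

schedule-within : ∀ {d} Ms I → All (λ j → r j + p j ≤ d) I →
  All (Within d (length (final d Ms I))) (slots I (schedule d Ms I))
schedule-within         Ms []      _             = []
schedule-within {d} Ms (j ∷ I) (fit ∷ fits) with place d j Ms
... | Ms′ , a , q =
  (proj₁ (place-within q fit) , proj₂ (place-within q fit) ,
    <-≤-trans (proj₁ (place-length q)) (final-length d Ms′ I)) ∷
  schedule-within Ms′ I fits

-- Machine ends never decrease, and each job starts after the current end of its machine. Applied
-- right after a placement, this separates the placed job from all later ones.
schedule-later : ∀ d Ms I →
  All (λ s → endAt (machineOf s) Ms ≤ onset s) (slots I (schedule d Ms I))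
schedule-later d Ms []      = []
schedule-later d Ms (j ∷ I) with place d j Ms
... | Ms′ , a , q = endAt-start q ∷
  All.map (λ {s} → ≤-trans (endAt-mono q (machineOf s))) (schedule-later d Ms′ I)

schedule-separate : ∀ d Ms I → AllPairs Separate (slots I (schedule d Ms I))
schedule-separate d Ms []      = []
schedule-separate d Ms (j ∷ I) with place d j Ms
... | Ms′ , a , q =
  All.map (λ {s} → apart {s}) (schedule-later d Ms′ I) ∷ schedule-separate d Ms′ I
  where
  apart : ∀ {s} → endAt (machineOf s) Ms′ ≤ onset s → Separate (j , a) s
  apart e≤s refl = inj₁ (≤-trans (≤-reflexive (sym (place-endAt q))) e≤s)

firstFit-feasible : ∀ {d} I → All (λ j → r j + p j ≤ d) I →
  Feasible d I (firstFit d I) (length (final d [] I))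
firstFit-feasible {d} I fits = schedule-length d [] I ,
  (λ i x a → slots-lookup I S i (schedule-within [] I fits)) ,
  (λ i j x y a b → slots-separate I S i j (schedule-separate d [] I))
  where
  S : List Assign
  S = firstFit d I

-- Counting machines

infixr 5 _∷_

-- The invariant of a machine at time `t`. Each job was admissible against the end of the jobs below
-- it, which bounds its start even when the older jobs are forgotten.
data History (d : ℕ) (c : Class) (t : ℕ) : List Job → Set where
  []  : History d c t []
  _∷_ : ∀ {j h} → r j ≤ t × Admissible d c j (end h) → History d c t h → History d c t (j ∷ h)

History-mono : ∀ {d c t u h} → t ≤ u → History d c t h → History d c u h
History-mono t≤u []                = []
History-mono t≤u ((r≤t , adm) ∷ H) = (≤-trans r≤t t≤u , adm) ∷ History-mono t≤u H

Valid : ℕ → ℕ → Machine → Set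
Valid d t (c , h) = History d c t h

place-valid : ∀ {d j Ms Ms′ a} → Place d j Ms Ms′ a →
  All (Valid d (r j)) Ms → All (Valid d (r j)) Ms′
place-valid (launch adm) []       = ((≤-refl , adm) ∷ []) ∷ []
place-valid (reuse adm)  (H ∷ Hs) = ((≤-refl , adm) ∷ H) ∷ Hs
place-valid (skip _ q)   (H ∷ Hs) = H ∷ place-valid q Hs

weight : (Job → ℕ) → List Machine → ℕ
weight f = sumBy (sumBy f ∘ proj₂)

place-weight : ∀ f {d j Ms Ms′ a} → Place d j Ms Ms′ a → weight f Ms′ ≡ f j + weight f Ms
place-weight f         (launch _)              = +-identityʳ _
place-weight f {j = j} (reuse _)               = +-assoc (f j) _ _
place-weight f {j = j} (skip {h = h} {Ms} _ q) =
  trans (cong (sumBy f h +_) (place-weight f q)) (exchange (sumBy f h) (f j) (weight f Ms))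
  where
  exchange : ∀ a b c → a + (b + c) ≡ b + (a + c)
  exchange = solve-∀

count : Class → List Machine → ℕ
count c = sumBy (λ M → 1 when (c ≟ᶜ proj₁ M))

length-count : ∀ Ms → length Ms ≡ count tight Ms + count loose Ms
length-count []                 = refl
length-count ((tight , _) ∷ Ms) = cong suc (length-count Ms)
length-count ((loose , _) ∷ Ms) =
  trans (cong suc (length-count Ms)) (sym (+-suc (count tight Ms) (count loose Ms)))

Blocked : ℕ → Job → Machine → Set
Blocked d j M = ¬ Admissible d (proj₁ M) j (endOf M)

place-count : ∀ {d j Ms Ms′ a} → Place d j Ms Ms′ a →
  (∀ c → count c Ms′ ≡ count c Ms) ⊎
  (∃ λ c₀ → Admissible d c₀ j 0 × All (Blocked d j) Ms ×
     ∀ c → count c Ms′ ≡ count c Ms + 1 when (c ≟ᶜ c₀))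
place-count (launch {c₀} adm) = inj₂ (c₀ , adm , [] , λ c → +-identityʳ _)
place-count (reuse _)         = inj₁ λ c → refl
place-count (skip {c₁} ¬adm q) with place-count q
... | inj₁ same = inj₁ λ c → cong (1 when (c ≟ᶜ c₁) +_) (same c)
... | inj₂ (c₀ , adm , blocked , more) = inj₂ (c₀ , adm , ¬adm ∷ blocked ,
  λ c → trans (cong (1 when (c ≟ᶜ c₁) +_) (more c)) (sym (+-assoc (1 when (c ≟ᶜ c₁)) _ _)))

-- Links blocked machines to the bounds on the optimum: it is applied to `running` with `K = 1` for
-- tight machines and to `charge` with `K = suc T` for loose ones.
count-weight : ∀ K (f : Job → ℕ) {d j t} c Ms →
  (∀ h → History d c t h → ¬ Admissible d c j (end h) → K ≤ sumBy f h) →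
  All (Valid d t) Ms → All (Blocked d j) Ms → K * count c Ms ≤ weight f Ms
count-weight K f {d} {j} {t} c Ms heavy valid blocked =
  ≤-trans (≤-reflexive (sym (sumBy-* K _ Ms)))
    (sumBy-mono (All.zipWith (λ {M} (V , B) → each M V B) (valid , blocked)))
  where
  each : ∀ M → Valid d t M → Blocked d j M → K * 1 when (c ≟ᶜ proj₁ M) ≤ sumBy f (proj₂ M)
  each (c₁ , h) V B with c ≟ᶜ c₁
  ... | yes refl = ≤-trans (≤-reflexive (*-identityʳ K)) (heavy h V B)
  ... | no  _    = ≤-trans (≤-reflexive (*-zeroʳ K)) z≤n

-- The latest job `i` of the machine started at its release, so the machine ends at `r i + p i`.
-- Being blocked means that this exceeds `r j`, hence `i` is running.
tight-blocked : ∀ {d} j → d < r j + 4 * p j → ∀ h → History d tight (r j) h →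
  ¬ Admissible d tight j (end h) → 1 ≤ sumBy (running d (r j)) h
tight-blocked j long []       _                            blocked = ⊥-elim (blocked (long , z≤n))
tight-blocked {d} j long (i ∷ h) ((i≤j , tight-i , e≤i) ∷ _) blocked =
  ≤-trans (≤-when (running? d (r j) i) (tight-i , i≤j , busy)) (m≤m+n _ _)
  where
  busy : r j < r i + p i
  busy = ≰⇒> λ done → blocked (long ,
    ≤-trans (≤-reflexive (cong (_+ p i) (m≥n⇒m⊔n≡m e≤i))) done)

-- Here `e` is the end of a loose machine and `V₂`, `V₃` are its work with `d - r` at most `2 T` and
-- `3 T`, where `d = t + T`. Either `V₂` accounts for all time beyond `t`, or an older job lies
-- below and `e` is at most both `t + T/6 + V₂` and `t - T/3 + V₃`.
Backlog : ℕ → ℕ → ℕ → ℕ → ℕ → Set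
Backlog t T e V₂ V₃ = e ≤ t + V₂ ⊎ (6 * e ≤ 6 * t + T + 6 * V₂ × 3 * e + T ≤ 3 * t + 3 * V₃)

-- If the new job starts at its release, it ends by `t + q`, which is the first alternative. If it
-- starts at `e`, the end and both work terms grow by at least matching amounts.
backlog-short : ∀ {t T ρ q e V₂ V₃ w₂ w₃} → ρ ≤ t → q ≤ w₂ → q ≤ w₃ →
  Backlog t T e V₂ V₃ → Backlog t T ((ρ ⊔ e) + q) (w₂ + V₂) (w₃ + V₃)
backlog-short {t} {T} {ρ} {q} {e} {V₂} {V₃} {w₂} {w₃} ρ≤t q≤w₂ q≤w₃ = extend (≤-total e ρ)
  where
  add : ∀ a w v → a + v + w ≡ a + (w + v)
  add = solve-∀
  add₆ : ∀ a w v → 6 * w + (a + 6 * v) ≡ a + 6 * (w + v)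
  add₆ = solve-∀
  add₃ : ∀ a w v → 3 * w + (a + 3 * v) ≡ a + 3 * (w + v)
  add₃ = solve-∀
  spread₆ : ∀ e q → 6 * (e + q) ≡ 6 * q + 6 * e
  spread₆ = solve-∀
  spread₃ : ∀ e q T → 3 * (e + q) + T ≡ 3 * q + (3 * e + T)
  spread₃ = solve-∀
  extend : e ≤ ρ ⊎ ρ ≤ e → Backlog t T e V₂ V₃ → Backlog t T ((ρ ⊔ e) + q) (w₂ + V₂) (w₃ + V₃)
  extend (inj₁ e≤ρ) _ rewrite m≥n⇒m⊔n≡m e≤ρ =
    inj₁ (+-mono-≤ ρ≤t (≤-trans q≤w₂ (m≤m+n w₂ V₂)))
  extend (inj₂ ρ≤e) (inj₁ e≤) rewrite m≤n⇒m⊔n≡n ρ≤e =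
    inj₁ (≤-trans (+-mono-≤ e≤ q≤w₂) (≤-reflexive (add t w₂ V₂)))
  extend (inj₂ ρ≤e) (inj₂ (six , three)) rewrite m≤n⇒m⊔n≡n ρ≤e = inj₂
    ( ≤-trans (≤-reflexive (spread₆ e q))
        (≤-trans (+-mono-≤ (*-monoʳ-≤ 6 q≤w₂) six) (≤-reflexive (add₆ (6 * t + T) w₂ V₂)))
    , ≤-trans (≤-reflexive (spread₃ e q T))
        (≤-trans (+-mono-≤ (*-monoʳ-≤ 3 q≤w₃) three) (≤-reflexive (add₃ (3 * t) w₃ V₃))) )

-- A job with d - r > 2 T that is unfinished at time t = d - T ends by t + T / 6,
-- has d - r ≤ 3 T and started before t - T / 3.
backlog-long : ∀ {t T j e V₂ V₃} → r j + 4 * p j ≤ t + T → 3 * e ≤ 2 * r j + (t + T) →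
  r j + T ≤ t → (t + T ≤ r j + 3 * T → p j ≤ V₃) →
  Backlog t T ((r j ⊔ e) + p j) V₂ V₃
backlog-long {t} {T} {j} {e} {V₂} {V₃} short wait early counted
  with (r j ⊔ e) + p j ≤? t
... | yes done   = inj₁ (≤-trans done (m≤m+n t V₂))
... | no  undone = inj₂ (≤-trans six (m≤m+n _ _) , three)
  where
  s f : ℕ
  s = r j ⊔ e
  f = s + p j
  finish≤ : 12 * f ≤ 5 * r j + 7 * (t + T)
  finish≤ = loose-finish {j = j} short wait
  six : 6 * f ≤ 6 * t + T
  six = *-cancelˡ-≤ 2 (linear (5 * r j + 5 * T)
    (+-mono-≤ finish≤ (*-monoʳ-≤ 5 early)) (lhs f (r j) T) (rhs t (r j) T))
    where
    lhs : ∀ f ρ T → 2 * (6 * f) + (5 * ρ + 5 * T) ≡ 12 * f + 5 * (ρ + T)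
    lhs = solve-∀
    rhs : ∀ t ρ T → 5 * ρ + 7 * (t + T) + 5 * t ≡ 2 * (6 * t + T) + (5 * ρ + 5 * T)
    rhs = solve-∀
  -- Ending no earlier than `t` gives `12 t ≤ 5 r + 7 (t + T)`, that is `d - r ≤ 12/5 T`, which is
  -- rounded up to `3 T`.
  recent : t + T ≤ r j + 3 * T
  recent = *-cancelˡ-≤ 5 (linear (7 * t)
    (+-mono-≤ (≤-trans (*-monoʳ-≤ 12 (≰⇒≥ undone)) finish≤) (*-monoˡ-≤ T 5≤8))
    (lhs t T) (rhs t (r j) T))
    where
    5≤8 : 5 ≤ 8
    5≤8 = m≤m+n 5 3
    lhs : ∀ t T → 5 * (t + T) + 7 * t ≡ 12 * t + 5 * T
    lhs = solve-∀
    rhs : ∀ t ρ T → 5 * ρ + 7 * (t + T) + 8 * T ≡ 5 * (ρ + 3 * T) + 7 * t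
    rhs = solve-∀
  three : 3 * f + T ≤ 3 * t + 3 * V₃
  three = ≤-trans (≤-reflexive (spread s (p j) T))
    (+-mono-≤ started (*-monoʳ-≤ 3 (counted recent)))
    where
    spread : ∀ s q T → 3 * (s + q) + T ≡ 3 * s + T + 3 * q
    spread = solve-∀
    started : 3 * s + T ≤ 3 * t
    started = linear (2 * r j + T)
      (+-mono-≤ (loose-start {j = j} {e} short wait) (*-monoʳ-≤ 2 early))
      (lhs s (r j) T) (rhs t (r j) T)
      where
      lhs : ∀ s ρ T → 3 * s + T + (2 * ρ + T) ≡ 3 * s + 2 * (ρ + T)
      lhs = solve-∀
      rhs : ∀ t ρ T → 2 * ρ + (t + T) + 2 * t ≡ 3 * t + (2 * ρ + T)
      rhs = solve-∀

-- The recursion runs from the latest job backwards and stops at the first job with `d - r > 2 T`: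
-- its own waiting bound replaces everything before it.
backlog : ∀ t T h → History (t + T) loose t h →
  Backlog t T (end h) (sumBy (work (t + T) (2 * T)) h) (sumBy (work (t + T) (3 * T)) h)
backlog t T []      _ = inj₁ z≤n
backlog t T (j ∷ h) ((r≤t , short , wait) ∷ H) with t + T ≤? r j + 2 * T
... | yes recent = backlog-short {w₂ = p j} {work (t + T) (3 * T) j} r≤t ≤-refl
        (≤-when (t + T ≤? r j + 3 * T) (≤-trans recent (+-monoʳ-≤ (r j) (*-monoˡ-≤ T 2≤3))))
        (backlog t T h H)
  where
  2≤3 : 2 ≤ 3
  2≤3 = m≤m+n 2 1
... | no early = backlog-long {j = j} short wait
        (<⇒≤ (+-cancelʳ-< T (r j + T) t (≤-<-trans (≤-reflexive (twice (r j) T)) (≰⇒> early))))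
        (λ recent → ≤-trans (≤-when (t + T ≤? r j + 3 * T) recent) (m≤m+n _ _))
  where
  twice : ∀ ρ T → ρ + T + T ≡ ρ + 2 * T
  twice = solve-∀

-- The weights 2 and 1 give every blocked loose machine more than `T`, while the optimum allows at
-- most `m (2 * 2 T + 3 T) = 7 m T` in total.
charge : ℕ → ℕ → Job → ℕ
charge d T j = 2 * work d (2 * T) j + work d (3 * T) j

sumBy-charge : ∀ d T I →
  sumBy (charge d T) I ≡ 2 * sumBy (work d (2 * T)) I + sumBy (work d (3 * T)) I
sumBy-charge d T I = trans (sumBy-+ (λ j → 2 * work d (2 * T) j) (work d (3 * T)) I)
  (cong (_+ sumBy (work d (3 * T)) I) (sumBy-* 2 (work d (2 * T)) I))

work-mono : ∀ d T h → sumBy (work d (2 * T)) h ≤ sumBy (work d (3 * T)) h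
work-mono d T = λ h → sumBy-mono (All.universal each h)
  where
  each : ∀ j → work d (2 * T) j ≤ work d (3 * T) j
  each j = when-≤ (d ≤? r j + 2 * T) λ recent → ≤-when (d ≤? r j + 3 * T)
    (≤-trans recent (+-monoʳ-≤ (r j) (*-monoˡ-≤ T (m≤m+n 2 1))))

-- Blocked means `end h > t + T/3`. The first alternative of `Backlog` gives `V₃ ≥ V₂ > T/3`; the
-- second gives `V₂ > T/6` and `V₃ > 2T/3`. Either way `2 V₂ + V₃ > T`.
loose-blocked : ∀ {j T} → r j + 4 * p j ≤ r j + T → ∀ h → History (r j + T) loose (r j) h →
  ¬ Admissible (r j + T) loose j (end h) → suc T ≤ sumBy (charge (r j + T) T) h
loose-blocked {j} {T} short h H blocked =
  ≤-trans (conclude (backlog t T h H)) (≤-reflexive (sym (sumBy-charge (t + T) T h)))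
  where
  t V₂ V₃ : ℕ
  t = r j
  V₂ = sumBy (work (t + T) (2 * T)) h
  V₃ = sumBy (work (t + T) (3 * T)) h
  late : 2 * t + (t + T) < 3 * end h
  late = ≰⇒> λ wait → blocked (short , wait)
  conclude : Backlog t T (end h) V₂ V₃ → suc T ≤ 2 * V₂ + V₃
  conclude (inj₁ e≤) = ≤-trans
    (linear (3 * t) (≤-trans late (*-monoʳ-≤ 3 e≤)) (lhs t T) (rhs t V₂))
    (+-monoʳ-≤ (2 * V₂) (work-mono (t + T) T h))
    where
    lhs : ∀ t T → suc T + 3 * t ≡ suc (2 * t + (t + T))
    lhs = solve-∀
    rhs : ∀ t v → 3 * (t + v) ≡ 2 * v + v + 3 * t
    rhs = solve-∀
  -- Doubling both bounds produces `12 V₂ + 6 V₃`; six copies of `late` then cancel the 18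
  -- occurrences of `end h`.
  conclude (inj₂ (six , three)) = *-cancelˡ-≤ 6 (linear (18 * end h + 18 * t + 2 * T)
    (+-mono-≤ (*-monoʳ-≤ 2 (+-mono-≤ six three)) (*-monoʳ-≤ 6 late))
    (lhs (end h) t T) (rhs (end h) t T V₂ V₃))
    where
    lhs : ∀ e t T → 6 * suc T + (18 * e + 18 * t + 2 * T) ≡
      2 * (6 * e + (3 * e + T)) + 6 * suc (2 * t + (t + T))
    lhs = solve-∀
    rhs : ∀ e t T v w → 2 * ((6 * t + T + 6 * v) + (3 * t + 3 * w)) + 6 * (3 * e) ≡
      6 * (2 * v + w) + (18 * e + 18 * t + 2 * T)
    rhs = solve-∀

-- Competitiveness

module Competitive {d m I S} (feasible : Feasible d I S m) where

  open Optimum {I = I} {S} feasible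

  Quotas : List Machine → Set
  Quotas Ms = count tight Ms ≤ m * 4 × count loose Ms ≤ m * 7

  charge-bound : ∀ T → sumBy (charge d T) I ≤ m * (7 * T)
  charge-bound T = ≤-trans (≤-reflexive (sumBy-charge d T I))
    (≤-trans (+-mono-≤ (*-monoʳ-≤ 2 (work-bound (2 * T))) (work-bound (3 * T)))
      (≤-reflexive (total m T)))
    where
    total : ∀ m T → 2 * (m * (2 * T)) + m * (3 * T) ≡ m * (7 * T)
    total = solve-∀

  -- The new job is itself running at its release, so it is counted together with one running job
  -- from each blocked tight machine.
  tight-quota : ∀ {j} Ms → 1 ≤ p j → r j + p j ≤ d → Admissible d tight j 0 →
    (∀ f → f j + weight f Ms ≤ sumBy f I) →
    All (Valid d (r j)) Ms → All (Blocked d j) Ms → count tight Ms + 1 ≤ m * 4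
  tight-quota {j} Ms 1≤p fits (long , _) budget valid blocked = begin
    count tight Ms + 1              ≡⟨ +-comm _ 1 ⟩
    1 + count tight Ms              ≡⟨ cong suc (*-identityˡ (count tight Ms)) ⟨
    1 + 1 * count tight Ms          ≤⟨ +-mono-≤ (≤-when (running? d (r j) j) (long , ≤-refl , busy)) many ⟩
    running d (r j) j + weight _ Ms ≤⟨ budget (running d (r j)) ⟩
    sumBy (running d (r j)) I       ≤⟨ running-bound (<-≤-trans busy fits) ⟩
    m * 4                           ∎
    where
    open ≤-Reasoning
    busy : r j < r j + p j
    busy = m<m+n (r j) 1≤p
    many : 1 * count tight Ms ≤ weight (running d (r j)) Ms
    many = count-weight 1 (running d (r j)) tight Ms (tight-blocked j long) valid blocked

  -- The new job has a positive charge of its own. This makes the chain strict and leaves room for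
  -- the machine it opens.
  loose-quota : ∀ {j} Ms → 1 ≤ p j → r j ≤ d → Admissible d loose j 0 →
    (∀ f → f j + weight f Ms ≤ sumBy f I) →
    All (Valid d (r j)) Ms → All (Blocked d j) Ms → count loose Ms + 1 ≤ m * 7
  loose-quota {j} Ms 1≤p r≤d adm budget valid blocked =
    ≤-trans (≤-reflexive (+-comm (count loose Ms) 1)) (*-cancelˡ-< (suc T) _ _ (begin-strict
      suc T * count loose Ms             ≤⟨ many d (sym (m+[n∸m]≡n r≤d)) adm valid blocked ⟩
      weight (charge d T) Ms             <⟨ m<n+m _ own ⟩
      charge d T j + weight (charge d T) Ms ≤⟨ budget (charge d T) ⟩
      sumBy (charge d T) I               ≤⟨ charge-bound T ⟩
      m * (7 * T)                        ≡⟨ trans (sym (*-assoc m 7 T)) (*-comm (m * 7) T) ⟩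
      T * (m * 7)                        ≤⟨ m≤n+m _ (m * 7) ⟩
      suc T * (m * 7)                    ∎))
    where
    open ≤-Reasoning
    T : ℕ
    T = d ∸ r j
    -- `T` is defined from `d`, so `d` is generalized to `d′` before being replaced by `r j + T`.
    many : ∀ d′ → d′ ≡ r j + T → Admissible d′ loose j 0 →
      All (Valid d′ (r j)) Ms → All (Blocked d′ j) Ms →
      suc T * count loose Ms ≤ weight (charge d′ T) Ms
    many _ refl (short , _) =
      count-weight (suc T) (charge (r j + T) T) loose Ms (loose-blocked {j} short)
    own : 0 < charge d T j
    own = ≤-trans 1≤p (≤-trans (≤-when (d ≤? r j + 3 * T)
      (≤-trans (≤-reflexive (sym (m+[n∸m]≡n r≤d))) (+-monoʳ-≤ (r j) (m≤m+n T (2 * T)))))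
      (m≤n+m _ _))

  place-quotas : ∀ {j Ms Ms′ a} → Place d j Ms Ms′ a → 1 ≤ p j → r j + p j ≤ d →
    (∀ f → f j + weight f Ms ≤ sumBy f I) →
    All (Valid d (r j)) Ms → Quotas Ms → Quotas Ms′
  place-quotas {j} {Ms} q 1≤p fits budget valid (qt , ql) with place-count q
  ... | inj₁ same rewrite same tight | same loose = qt , ql
  ... | inj₂ (tight , adm , blocked , more) rewrite more tight | more loose | +-identityʳ (count loose Ms) =
    tight-quota Ms 1≤p fits adm budget valid blocked , ql
  ... | inj₂ (loose , adm , blocked , more) rewrite more tight | more loose | +-identityʳ (count tight Ms) =
    qt , loose-quota Ms 1≤p (m+n≤o⇒m≤o (r j) fits) adm budget valid blocked

  -- The budget hypothesis expresses that placed and pending jobs together are drawn from `I`. It is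
  -- kept for all `f`, because the functions used depend on the release date at which a machine is
  -- opened.
  final-quotas : ∀ {t} J Ms → AllPairs (λ i j → r i ≤ r j) J → All (λ j → t ≤ r j) J →
    All (λ j → 1 ≤ p j) J → All (λ j → r j + p j ≤ d) J →
    (∀ f → sumBy f J + weight f Ms ≤ sumBy f I) →
    All (Valid d t) Ms → Quotas Ms → Quotas (final d Ms J)
  final-quotas []      Ms _ _ _ _ _ _ quotas = quotas
  final-quotas (j ∷ J) Ms (j≤ ∷ sorted) (t≤j ∷ _) (pos ∷ poss) (fit ∷ fits) budget valid quotas
    with place d j Ms
  ... | Ms′ , a , q = final-quotas J Ms′ sorted j≤ poss fits budget′ (place-valid q valid′)
    (place-quotas q pos fit now valid′ quotas)
    where
    valid′ : All (Valid d (r j)) Ms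
    valid′ = All.map (History-mono t≤j) valid
    exchange : ∀ a b c → b + (a + c) ≡ a + b + c
    exchange = solve-∀
    budget′ : ∀ f → sumBy f J + weight f Ms′ ≤ sumBy f I
    budget′ f = ≤-trans (≤-reflexive (trans (cong (sumBy f J +_) (place-weight f q))
      (exchange (f j) (sumBy f J) (weight f Ms)))) (budget f)
    now : ∀ f → f j + weight f Ms ≤ sumBy f I
    now f = ≤-trans (+-monoˡ-≤ (weight f Ms) (m≤m+n (f j) (sumBy f J))) (budget f)

firstFit-competitive : Competitive-100/9 firstFit
firstFit-competitive d I sorted positive m ((S , feasible) , _) =
  length Ms , firstFit-feasible I fits , few
  where
  open Competitive {d} {m} {I} {S} feasible
  Ms : List Machine
  Ms = final d [] I
  -- The given optimal schedule witnesses that every job fits between its release and `d`.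
  fits : All (λ j → r j + p j ≤ d) I
  fits = window I S (proj₁ feasible) (feasible⇒within I S feasible)
    where
    window : ∀ I S → length S ≡ length I → All (Within d m) (slots I S) →
      All (λ j → r j + p j ≤ d) I
    window []      _       _   _                     = []
    window (x ∷ I) (a ∷ S) len ((r≤s , s≤d , _) ∷ ws) =
      ≤-trans (+-monoˡ-≤ (p x) r≤s) s≤d ∷ window I S (suc-injective len) ws
  quotas : Quotas Ms
  quotas = final-quotas {0} I [] (Linked⇒AllPairs ≤-trans sorted) (All.universal (λ _ → z≤n) I)
    positive fits (λ f → ≤-reflexive (+-identityʳ _)) [] (z≤n , z≤n)
  few : 9 * length Ms ≤ 100 * m
  few = begin
    9 * length Ms                          ≡⟨ cong (9 *_) (length-count Ms) ⟩
    9 * (count tight Ms + count loose Ms)  ≤⟨ *-monoʳ-≤ 9 (+-mono-≤ (proj₁ quotas) (proj₂ quotas)) ⟩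
    9 * (m * 4 + m * 7)                    ≡⟨ total m ⟩
    99 * m                                 ≤⟨ *-monoˡ-≤ m (n≤1+n 99) ⟩
    100 * m                                ∎
    where
    open ≤-Reasoning
    total : ∀ m → 9 * (m * 4 + m * 7) ≡ 99 * m
    total = solve-∀

theorem17 : Σ Algorithm λ A → Online A × Competitive-100/9 A
theorem17 = firstFit , firstFit-online , firstFit-competitive
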